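{- Let $F(x)=\sum_{n\geqslant 0}|\mathcal{I}_n(102,201)|\,x^n$. Then $$F(x)=\frac{ -8x^4+18x^3-10x^2-8x+4+2(2x-1)(x^2-2x+2)\sqrt{(5x-1)(x-1)}}{4x(2x-1)(x-1)(x-2)^2},$$ where $\sqrt{(5x-1)(x-1)}$ denotes the formal power series square root of $1-6x+5x^2$ with constant term $1$.
   Context: For $n\in\mathbb N$, an inversion sequence of size $n$ is a sequence $\sigma=(\sigma_1,\dots,\sigma_n)\in\mathbb N^n$ with $\sigma_i<i$ for all $i$ (there is one, empty, inversion sequence of size $0$). An integer sequence contains a pattern $\rho$ (a finite integer sequence such as $102$ or $201$) if it has a subsequence order-isomorphic to $\rho$, and avoids $\rho$ otherwise. $\mathcal{I}_n(P)$ denotes the set of inversion sequences of size $n$ avoiding every pattern in $P$. -}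

module Defs where

open import Data.Nat using (ℕ; zero; suc; _<_; _∸_)
open import Data.Nat.Properties using (_<?_)
open import Data.Integer using (ℤ; +_) renaming (_+_ to _+ℤ_; _*_ to _*ℤ_)
open import Data.List using (List; []; _∷_; _++_; [_]; map; concatMap; upTo; zip; filter; length)
open import Data.List.Relation.Unary.All using (All; all?)
open import Data.List.Relation.Unary.Any using (Any; any?)
open import Data.Product using (_×_; _,_)
open import Data.Unit using (⊤; tt)
open import Data.Empty using (⊥)
open import Relation.Nullary using (Dec; yes; no; ¬_; ¬?)
open import Relation.Nullary.Decidable using (_×-dec_; _→-dec_)

-- All inversion sequences of size n, as lists (σ₁, …, σₙ) with σᵢ < i.
-- Size n+1: extend a size-n sequence by a last entry σ_{n+1} ∈ {0,…,n}.
invSeqs : ℕ → List (List ℕ)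
invSeqs zero    = [] ∷ []
invSeqs (suc n) = concatMap (λ σ → map (λ k → σ ++ [ k ]) (upTo (suc n))) (invSeqs n)

subseqs : List ℕ → List (List ℕ)
subseqs []       = [] ∷ []
subseqs (x ∷ xs) = map (x ∷_) (subseqs xs) ++ subseqs xs

SameOrder : ℕ → ℕ → ℕ → ℕ → Set
SameOrder a b x y = ((a < x → b < y) × (b < y → a < x)) × ((x < a → y < b) × (y < b → x < a))

-- τ and ρ are order-isomorphic: same length and every pair of positions
-- compares the same way (< in both directions, hence also =).
OrderIso : List ℕ → List ℕ → Set
OrderIso []       []       = ⊤
OrderIso []       (_ ∷ _)  = ⊥
OrderIso (_ ∷ _)  []       = ⊥
OrderIso (a ∷ as) (b ∷ bs) =
  All (λ p → SameOrder a b (Data.Product.proj₁ p) (Data.Product.proj₂ p)) (zip as bs)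
  × OrderIso as bs

Contains : List ℕ → List ℕ → Set
Contains ρ σ = Any (λ τ → OrderIso τ ρ) (subseqs σ)

sameOrder? : ∀ a b x y → Dec (SameOrder a b x y)
sameOrder? a b x y =
  (((a <? x) →-dec (b <? y)) ×-dec ((b <? y) →-dec (a <? x)))
  ×-dec (((x <? a) →-dec (y <? b)) ×-dec ((y <? b) →-dec (x <? a)))

orderIso? : ∀ τ ρ → Dec (OrderIso τ ρ)
orderIso? []       []       = yes tt
orderIso? []       (_ ∷ _)  = no (λ ())
orderIso? (_ ∷ _)  []       = no (λ ())
orderIso? (a ∷ as) (b ∷ bs) =
  all? (λ p → sameOrder? a b (Data.Product.proj₁ p) (Data.Product.proj₂ p)) (zip as bs)
  ×-dec orderIso? as bs

contains? : ∀ ρ σ → Dec (Contains ρ σ)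
contains? ρ σ = any? (λ τ → orderIso? τ ρ) (subseqs σ)

AvoidsAll : List (List ℕ) → List ℕ → Set
AvoidsAll P σ = All (λ ρ → ¬ Contains ρ σ) P

avoidsAll? : ∀ P σ → Dec (AvoidsAll P σ)
avoidsAll? P σ = all? (λ ρ → ¬? (contains? ρ σ)) P

countAvoiders : List (List ℕ) → ℕ → ℕ
countAvoiders P n = length (filter (avoidsAll? P) (invSeqs n))

p102 p201 : List ℕ
p102 = 1 ∷ 0 ∷ 2 ∷ []
p201 = 2 ∷ 0 ∷ 1 ∷ []

PS : Set
PS = ℕ → ℤ

_⊕_ : PS → PS → PS
(f ⊕ g) n = f n +ℤ g n

convSum : PS → PS → ℕ → ℕ → ℤ
convSum f g n zero    = f 0 *ℤ g n
convSum f g n (suc k) = f (suc k) *ℤ g (n ∸ suc k) +ℤ convSum f g n k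

_⊛_ : PS → PS → PS
(f ⊛ g) n = convSum f g n n

infixl 7 _⊛_
infixl 6 _⊕_

poly : List ℤ → PS
poly []       _       = + 0
poly (c ∷ cs) zero    = c
poly (c ∷ cs) (suc n) = poly cs n

F : PS
F n = + countAvoiders (p102 ∷ p201 ∷ []) n

{-# OPTIONS --safe #-}

-- Avoiding 102 and 201 means: if b lies below an earlier a and a later c, then a = c.
-- Hence the continuations of an avoiding prefix depend only on one of three states.
--   Rising:  weakly increasing so far, with maximum M and second largest value m;
--   Valley:  only the value M lies above the lowest descent k, and the next entry
--            is M or at most k;
--   Falling: two values lie above the last entry k, and the next entry is at most k.
-- With Y = 1/(1-x), the continuations of a Falling state are counted by Y^(k+1), those of
-- a Valley state by Y^k/(1-2x).  For a Rising state of length M+h, the kernel root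
-- Λ = Y + xΛ² and Q = (2-x)²(1-2x) give a generating function R with
--   Q R = Y^M (2-2x+2x² - x²Y(2-x)h + (1-2x)(2-2x+x²)Λ^(h+1)) - xY(2-x)² Y^m,
-- because both sides satisfy the same recursion, which determines them coefficientwise.
-- The theorem is the case h = M = m = 0, with Λ = (1 - Y√(1-6x+5x²))/(2x).

module Submission where

open import Defs
open import Data.Nat using (ℕ; zero; suc; _∸_; z≤n; s≤s) renaming (_+_ to _+ℕ_; _≤_ to _≤ℕ_; _<_ to _<ℕ_)
import Data.Nat.Properties as ℕ
import Data.Nat.Tactic.RingSolver as ℕSolver
open import Data.Integer using (ℤ; +_; -[1+_]; _+_; _*_; -_)
import Data.Integer.Properties as ℤ
open import Data.Integer.Tactic.RingSolver using (solve-∀)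
open import Data.Bool using (true; false; if_then_else_)
open import Data.Empty using (⊥-elim)
open import Data.List using (List; []; _∷_; [_]; _++_; map; concatMap; applyUpTo; upTo; filter; length)
open import Data.List.Relation.Unary.All using ([]; _∷_)
open import Data.List.Relation.Unary.Any using (Any; here)
import Data.List.Relation.Unary.Any.Properties as Any
open import Data.List.Relation.Binary.Sublist.Propositional using (_⊆_; []; _∷_; _∷ʳ_; ⊆-refl; minimum)
open import Data.List.Relation.Binary.Sublist.Propositional.Properties using (++⁺; ++⁺ʳ)
open import Data.Maybe using (Maybe; just; nothing)
open import Data.Product using (_×_; _,_; ∃; proj₁; proj₂)
open import Data.Sum as Sum using (_⊎_; inj₁; inj₂; [_,_]′)
open import Data.Unit using (tt)
open import Function using (_∘_; id)
open import Relation.Nullary using (Dec; does; yes; no; ¬_)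
open import Relation.Nullary.Decidable using (dec-true; dec-false)
open import Relation.Binary using (tri<; tri≈; tri>)
open import Relation.Binary.PropositionalEquality hiding ([_])
open import Algebra.Bundles using (CommutativeRing)
import Algebra.Properties.AbelianGroup ℤ.+-0-abelianGroup as ℤG
open import Algebra.Solver.Ring.AlmostCommutativeRing using (fromCommutativeRing; _-Raw-AlmostCommutative⟶_)
import Algebra.Solver.Ring as RingSolver
import Relation.Binary.Reasoning.Setoid as SetoidReasoning

-- The ring of formal power series

infix 4 _≈_
_≈_ : PS → PS → Set
f ≈ g = ∀ n → f n ≡ g n

tail : PS → PS
tail f n = f (suc n)

con : ℤ → PS
con c = poly (c ∷ [])

infix 8 ⊝_
⊝_ : PS → PS
(⊝ f) n = - f n

_·_ : ℤ → PS → PS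
(c · f) n = c * f n

-- `convSum` peels off the summand with the largest index of `f`. Peeling off the one with `f 0`
-- instead leaves a convolution of `tail f`, so the ring laws below follow by induction on the
-- coefficient index.
convSum-tail : ∀ f g n k → convSum f g (suc n) (suc k) ≡ f 0 * g (suc n) + convSum (tail f) g n k
convSum-tail f g n zero    = ℤ.+-comm (f 1 * g n) (f 0 * g (suc n))
convSum-tail f g n (suc k) = begin
  f (suc (suc k)) * g (n ∸ suc k) + convSum f g (suc n) (suc k)
    ≡⟨ cong (λ z → f (suc (suc k)) * g (n ∸ suc k) + z) (convSum-tail f g n k) ⟩
  f (suc (suc k)) * g (n ∸ suc k) + (f 0 * g (suc n) + convSum (tail f) g n k)
    ≡⟨ swap (f (suc (suc k)) * g (n ∸ suc k)) (f 0 * g (suc n)) _ ⟩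
  f 0 * g (suc n) + (f (suc (suc k)) * g (n ∸ suc k) + convSum (tail f) g n k) ∎
  where
  open ≡-Reasoning
  swap : ∀ a b c → a + (b + c) ≡ b + (a + c)
  swap = solve-∀

⊛-tailˡ : ∀ f g n → (f ⊛ g) (suc n) ≡ f 0 * g (suc n) + (tail f ⊛ g) n
⊛-tailˡ f g n = convSum-tail f g n n

⊛-tailʳ : ∀ f g n → (f ⊛ g) (suc n) ≡ f (suc n) * g 0 + (f ⊛ tail g) n
⊛-tailʳ f g zero    = refl
⊛-tailʳ f g (suc n) = begin
  (f ⊛ g) (suc (suc n))
    ≡⟨ ⊛-tailˡ f g (suc n) ⟩
  f 0 * g (suc (suc n)) + (tail f ⊛ g) (suc n)
    ≡⟨ cong (λ z → f 0 * g (suc (suc n)) + z) (⊛-tailʳ (tail f) g n) ⟩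
  f 0 * g (suc (suc n)) + (f (suc (suc n)) * g 0 + (tail f ⊛ tail g) n)
    ≡⟨ swap (f 0 * g (suc (suc n))) (f (suc (suc n)) * g 0) _ ⟩
  f (suc (suc n)) * g 0 + (f 0 * g (suc (suc n)) + (tail f ⊛ tail g) n)
    ≡⟨ cong (λ z → f (suc (suc n)) * g 0 + z) (sym (⊛-tailˡ f (tail g) n)) ⟩
  f (suc (suc n)) * g 0 + (f ⊛ tail g) (suc n) ∎
  where
  open ≡-Reasoning
  swap : ∀ a b c → a + (b + c) ≡ b + (a + c)
  swap = solve-∀

⊛-comm : ∀ f g → f ⊛ g ≈ g ⊛ f
⊛-comm f g zero    = ℤ.*-comm (f 0) (g 0)
⊛-comm f g (suc n) = begin
  (f ⊛ g) (suc n)                  ≡⟨ ⊛-tailˡ f g n ⟩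
  f 0 * g (suc n) + (tail f ⊛ g) n ≡⟨ cong₂ _+_ (ℤ.*-comm (f 0) _) (⊛-comm (tail f) g n) ⟩
  g (suc n) * f 0 + (g ⊛ tail f) n ≡⟨ sym (⊛-tailʳ g f n) ⟩
  (g ⊛ f) (suc n)                  ∎
  where open ≡-Reasoning

-- Agreement is asked for only at the indices that occur; `λ-step-contractive` knows no more than
-- that.
convSum-cong : ∀ {f f′ g g′} n k → (∀ i → i ≤ℕ k → f i ≡ f′ i) → (∀ i → i ≤ℕ n → g i ≡ g′ i) →
               convSum f g n k ≡ convSum f′ g′ n k
convSum-cong n zero    p q = cong₂ _*_ (p 0 z≤n) (q n ℕ.≤-refl)
convSum-cong n (suc k) p q =
  cong₂ _+_ (cong₂ _*_ (p (suc k) ℕ.≤-refl) (q (n ∸ suc k) (ℕ.m∸n≤m n (suc k))))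
            (convSum-cong n k (λ i i≤k → p i (ℕ.m≤n⇒m≤1+n i≤k)) q)

⊛-cong : ∀ {f f′ g g′} → f ≈ f′ → g ≈ g′ → f ⊛ g ≈ f′ ⊛ g′
⊛-cong p q n = convSum-cong n n (λ i _ → p i) (λ i _ → q i)

⊛-distribʳ : ∀ h f g → (f ⊕ g) ⊛ h ≈ f ⊛ h ⊕ g ⊛ h
⊛-distribʳ h f g zero    = ℤ.*-distribʳ-+ (h 0) (f 0) (g 0)
⊛-distribʳ h f g (suc n) = begin
  ((f ⊕ g) ⊛ h) (suc n)
    ≡⟨ ⊛-tailˡ (f ⊕ g) h n ⟩
  (f 0 + g 0) * h (suc n) + ((tail f ⊕ tail g) ⊛ h) n
    ≡⟨ cong (λ z → (f 0 + g 0) * h (suc n) + z) (⊛-distribʳ h (tail f) (tail g) n) ⟩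
  (f 0 + g 0) * h (suc n) + ((tail f ⊛ h) n + (tail g ⊛ h) n)
    ≡⟨ regroup (f 0) (g 0) (h (suc n)) _ _ ⟩
  (f 0 * h (suc n) + (tail f ⊛ h) n) + (g 0 * h (suc n) + (tail g ⊛ h) n)
    ≡⟨ sym (cong₂ _+_ (⊛-tailˡ f h n) (⊛-tailˡ g h n)) ⟩
  (f ⊛ h ⊕ g ⊛ h) (suc n) ∎
  where
  open ≡-Reasoning
  regroup : ∀ a b c d e → (a + b) * c + (d + e) ≡ (a * c + d) + (b * c + e)
  regroup = solve-∀

·-⊛ : ∀ c f g → (c · f) ⊛ g ≈ c · (f ⊛ g)
·-⊛ c f g zero    = ℤ.*-assoc c (f 0) (g 0)
·-⊛ c f g (suc n) = begin
  ((c · f) ⊛ g) (suc n)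
    ≡⟨ ⊛-tailˡ (c · f) g n ⟩
  c * f 0 * g (suc n) + ((c · tail f) ⊛ g) n
    ≡⟨ cong (λ z → c * f 0 * g (suc n) + z) (·-⊛ c (tail f) g n) ⟩
  c * f 0 * g (suc n) + c * (tail f ⊛ g) n
    ≡⟨ regroup c (f 0) (g (suc n)) _ ⟩
  c * (f 0 * g (suc n) + (tail f ⊛ g) n)
    ≡⟨ cong (c *_) (sym (⊛-tailˡ f g n)) ⟩
  c * (f ⊛ g) (suc n) ∎
  where
  open ≡-Reasoning
  regroup : ∀ a b c d → a * b * c + a * d ≡ a * (b * c + d)
  regroup = solve-∀

⊛-assoc : ∀ f g h → (f ⊛ g) ⊛ h ≈ f ⊛ (g ⊛ h)
⊛-assoc f g h zero    = ℤ.*-assoc (f 0) (g 0) (h 0)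
⊛-assoc f g h (suc n) = begin
  ((f ⊛ g) ⊛ h) (suc n)
    ≡⟨ ⊛-tailˡ (f ⊛ g) h n ⟩
  f 0 * g 0 * h (suc n) + (tail (f ⊛ g) ⊛ h) n
    ≡⟨ cong (λ z → f 0 * g 0 * h (suc n) + z) (⊛-cong {g = h} (⊛-tailˡ f g) (λ _ → refl) n) ⟩
  f 0 * g 0 * h (suc n) + ((f 0 · tail g ⊕ tail f ⊛ g) ⊛ h) n
    ≡⟨ cong (λ z → f 0 * g 0 * h (suc n) + z) (⊛-distribʳ h (f 0 · tail g) (tail f ⊛ g) n) ⟩
  f 0 * g 0 * h (suc n) + (((f 0 · tail g) ⊛ h) n + ((tail f ⊛ g) ⊛ h) n)
    ≡⟨ cong (λ z → f 0 * g 0 * h (suc n) + z) (cong₂ _+_ (·-⊛ (f 0) (tail g) h n) (⊛-assoc (tail f) g h n)) ⟩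
  f 0 * g 0 * h (suc n) + (f 0 * (tail g ⊛ h) n + (tail f ⊛ (g ⊛ h)) n)
    ≡⟨ regroup (f 0) (g 0) (h (suc n)) _ _ ⟩
  f 0 * (g 0 * h (suc n) + (tail g ⊛ h) n) + (tail f ⊛ (g ⊛ h)) n
    ≡⟨ cong (λ z → f 0 * z + (tail f ⊛ (g ⊛ h)) n) (sym (⊛-tailˡ g h n)) ⟩
  f 0 * (g ⊛ h) (suc n) + (tail f ⊛ (g ⊛ h)) n
    ≡⟨ sym (⊛-tailˡ f (g ⊛ h) n) ⟩
  (f ⊛ (g ⊛ h)) (suc n) ∎
  where
  open ≡-Reasoning
  regroup : ∀ a b c d e → a * b * c + (a * d + e) ≡ a * (b * c + d) + e
  regroup = solve-∀

con-⊛ : ∀ c f → con c ⊛ f ≈ c · f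
con-⊛ c f zero    = refl
con-⊛ c f (suc n) = begin
  (con c ⊛ f) (suc n)              ≡⟨ ⊛-tailˡ (con c) f n ⟩
  c * f (suc n) + (poly [] ⊛ f) n  ≡⟨ cong (λ z → c * f (suc n) + z) (poly[]-⊛ f n) ⟩
  c * f (suc n) + + 0              ≡⟨ ℤ.+-identityʳ _ ⟩
  c * f (suc n)                    ∎
  where
  open ≡-Reasoning
  poly[]-⊛ : ∀ f n → (poly [] ⊛ f) n ≡ + 0
  poly[]-⊛ f zero    = refl
  poly[]-⊛ f (suc n) = trans (⊛-tailˡ (poly []) f n) (trans (ℤ.+-identityˡ _) (poly[]-⊛ f n))

con-0 : ∀ n → con (+ 0) n ≡ + 0
con-0 zero    = refl
con-0 (suc n) = refl

⊛-identityˡ : ∀ f → con (+ 1) ⊛ f ≈ f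
⊛-identityˡ f n = trans (con-⊛ (+ 1) f n) (ℤ.*-identityˡ (f n))

psRing : CommutativeRing _ _
psRing = record
  { Carrier = PS ; _≈_ = _≈_ ; _+_ = _⊕_ ; _*_ = _⊛_ ; -_ = ⊝_ ; 0# = con (+ 0) ; 1# = con (+ 1)
  ; isCommutativeRing = record
    { isRing = record
      { +-isAbelianGroup = record
        { isGroup = record
          { isMonoid = record
            { isSemigroup = record
              { isMagma = record
                { isEquivalence = record
                  { refl = λ _ → refl ; sym = λ p n → sym (p n) ; trans = λ p q n → trans (p n) (q n) }
                ; ∙-cong = λ p q n → cong₂ _+_ (p n) (q n) }
              ; assoc = λ f g h n → ℤ.+-assoc (f n) (g n) (h n) }
            ; identity = (λ f n → trans (cong (_+ f n) (con-0 n)) (ℤ.+-identityˡ (f n)))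
                       , (λ f n → trans (cong (λ z → f n + z) (con-0 n)) (ℤ.+-identityʳ (f n))) }
          ; inverse = (λ f n → trans (ℤ.+-inverseˡ (f n)) (sym (con-0 n)))
                    , (λ f n → trans (ℤ.+-inverseʳ (f n)) (sym (con-0 n)))
          ; ⁻¹-cong = λ p n → cong -_ (p n) }
        ; comm = λ f g n → ℤ.+-comm (f n) (g n) }
      ; *-cong = ⊛-cong
      ; *-assoc = ⊛-assoc
      ; *-identity = ⊛-identityˡ , (λ f n → trans (⊛-comm f (con (+ 1)) n) (⊛-identityˡ f n))
      ; distrib = (λ f g h n → trans (⊛-comm f (g ⊕ h) n) (trans (⊛-distribʳ f g h n)
                                 (cong₂ _+_ (⊛-comm g f n) (⊛-comm h f n))))
                , ⊛-distribʳ }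
    ; *-comm = ⊛-comm } }

-- Integer coefficients let the solver compute with numerals: their equality is decidable, that of
-- power series is not.
conMorphism : CommutativeRing.rawRing ℤ.+-*-commutativeRing -Raw-AlmostCommutative⟶ fromCommutativeRing psRing
conMorphism = record
  { ⟦_⟧ = con
  ; +-homo = λ { a b zero → refl ; a b (suc n) → refl }
  ; *-homo = λ a b n → sym (trans (con-⊛ a (con b) n) (scale a b n))
  ; -‿homo = λ { a zero → refl ; a (suc n) → refl }
  ; 0-homo = λ _ → refl
  ; 1-homo = λ _ → refl }
  where
  scale : ∀ a b → a · con b ≈ con (a * b)
  scale a b zero    = refl
  scale a b (suc n) = ℤ.*-zeroʳ a

con-≟ : ∀ a b → Maybe (con a ≈ con b)
con-≟ a b with a ℤ.≟ b
... | yes refl = just (λ _ → refl)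
... | no _     = nothing

module Solver = RingSolver (CommutativeRing.rawRing ℤ.+-*-commutativeRing)
                           (fromCommutativeRing psRing) conMorphism con-≟
open Solver using (solve; _:+_; _:*_; _:-_; :-_; _:=_) renaming (con to K)
open CommutativeRing psRing using ()
  renaming (setoid to psSetoid; refl to ≈-refl; sym to ≈-sym; trans to ≈-trans; +-cong to ⊕-cong)
module ≈-Reasoning = SetoidReasoning psSetoid

-- Finite sums and geometric sums of power series

X : PS
X = poly (+ 0 ∷ + 1 ∷ [])

infixl 6 _⊖_
_⊖_ : PS → PS → PS
f ⊖ g = f ⊕ ⊝ g

∑ : ℕ → (ℕ → ℤ) → ℤ
∑ zero    f = + 0
∑ (suc n) f = f 0 + ∑ n (f ∘ suc)

∑-cong : ∀ n {f g} → (∀ i → i <ℕ n → f i ≡ g i) → ∑ n f ≡ ∑ n g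
∑-cong zero    p = refl
∑-cong (suc n) p = cong₂ _+_ (p 0 (s≤s z≤n)) (∑-cong n (λ i i<n → p (suc i) (s≤s i<n)))

∑ₚ : ℕ → (ℕ → PS) → PS
∑ₚ n f r = ∑ n (λ i → f i r)

∑ₚ-cong : ∀ n {f g : ℕ → PS} → (∀ i → f i ≈ g i) → ∑ₚ n f ≈ ∑ₚ n g
∑ₚ-cong n p r = ∑-cong n (λ i _ → p i r)

∑ₚ-⊕ : ∀ n f g → ∑ₚ n (λ i → f i ⊕ g i) ≈ ∑ₚ n f ⊕ ∑ₚ n g
∑ₚ-⊕ zero    f g r = refl
∑ₚ-⊕ (suc n) f g r =
  trans (cong (λ z → f 0 r + g 0 r + z) (∑ₚ-⊕ n (f ∘ suc) (g ∘ suc) r)) (regroup (f 0 r) (g 0 r) _ _)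
  where
  regroup : ∀ a b c d → a + b + (c + d) ≡ a + c + (b + d)
  regroup = solve-∀

∑ₚ-⊛ : ∀ n a f → ∑ₚ n (λ i → a ⊛ f i) ≈ a ⊛ ∑ₚ n f
-- The empty sum is `+ 0` at every index, which equals `con (+ 0)` only by cases on the index, so
-- `con-0` has to mediate before the solver applies.
∑ₚ-⊛ zero    a f = λ r → trans (sym (con-0 r)) (lem r)
  where
  lem : con (+ 0) ≈ a ⊛ ∑ₚ 0 f
  lem r = trans (solve 1 (λ a → K (+ 0) := a :* K (+ 0)) ≈-refl a r) (⊛-cong {f = a} {g = con (+ 0)} ≈-refl con-0 r)
∑ₚ-⊛ (suc n) a f = begin
  a ⊛ f 0 ⊕ ∑ₚ n (λ i → a ⊛ f (suc i))  ≈⟨ ⊕-cong {x = a ⊛ f 0} ≈-refl (∑ₚ-⊛ n a (f ∘ suc)) ⟩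
  a ⊛ f 0 ⊕ a ⊛ ∑ₚ n (f ∘ suc)
    ≈⟨ solve 3 (λ a b c → a :* b :+ a :* c := a :* (b :+ c)) ≈-refl a (f 0) (∑ₚ n (f ∘ suc)) ⟩
  a ⊛ ∑ₚ (suc n) f                      ∎
  where open ≈-Reasoning

-- Built by repeated addition of one, so that the solver can treat `num (suc n)` as one plus an
-- unknown.
num : ℕ → PS
num zero    = con (+ 0)
num (suc n) = con (+ 1) ⊕ num n

∑ₚ-const : ∀ n f → ∑ₚ n (λ _ → f) ≈ num n ⊛ f
∑ₚ-const zero    f r = sym (trans (con-⊛ (+ 0) f r) (ℤ.*-zeroˡ (f r)))
∑ₚ-const (suc n) f = begin
  f ⊕ ∑ₚ n (λ _ → f)   ≈⟨ ⊕-cong {x = f} ≈-refl (∑ₚ-const n f) ⟩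
  f ⊕ num n ⊛ f        ≈⟨ solve 2 (λ f n → f :+ n :* f := (K (+ 1) :+ n) :* f) ≈-refl f (num n) ⟩
  num (suc n) ⊛ f      ∎
  where open ≈-Reasoning

-- If f - g = k (a - b) and a ≈ b then f ≈ g: proves f ≈ g modulo a relation, with cofactor k.
combine : ∀ {f g a b} k → a ≈ b → f ⊕ k ⊛ b ≈ g ⊕ k ⊛ a → f ≈ g
combine {f} {g} {a} {b} k a≈b p n =
  ℤG.∙-cancelʳ ((k ⊛ b) n) (f n) (g n) (trans (p n) (cong (λ z → g n + z) (⊛-cong {f = k} ≈-refl a≈b n)))

X-suc : ∀ f n → (X ⊛ f) (suc n) ≡ f n
X-suc f n = trans (⊛-tailˡ X f n) (trans (ℤ.+-identityˡ _) (⊛-identityˡ f n))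

-- Turns a recursion on the number of remaining entries into a functional equation; the constant
-- coefficient counts the empty continuation.
shift-eq : ∀ {f g} → f 0 ≡ + 1 → (∀ n → f (suc n) ≡ g n) → f ≈ con (+ 1) ⊕ X ⊛ g
shift-eq p q zero    = p
shift-eq {g = g} p q (suc n) = trans (q n) (sym (trans (ℤ.+-identityˡ _) (X-suc g n)))

Y : PS
Y _ = + 1

Y-eq : (con (+ 1) ⊖ X) ⊛ Y ≈ con (+ 1)
Y-eq n = trans (solve 2 (λ x y → (K (+ 1) :- x) :* y := y :- x :* y) ≈-refl X Y n) (lem n)
  where
  lem : Y ⊖ X ⊛ Y ≈ con (+ 1)
  lem zero    = refl
  lem (suc n) = cong (λ z → + 1 + - z) (X-suc Y n)

infixr 8 _^ₚ_
_^ₚ_ : PS → ℕ → PS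
f ^ₚ zero  = con (+ 1)
f ^ₚ suc n = f ⊛ f ^ₚ n

-- From (1-x)Y = 1 follows xY = Y - 1, so each summand times x is a difference of consecutive powers
-- of `Y`, and the sum telescopes.
geometric : ∀ n s → X ⊛ ∑ₚ n (λ i → Y ^ₚ (suc (s +ℕ i))) ≈ Y ^ₚ (s +ℕ n) ⊖ Y ^ₚ s
geometric zero s = begin
  X ⊛ ∑ₚ 0 (λ i → Y ^ₚ (suc (s +ℕ i)))  ≈⟨ (λ r → sym (∑ₚ-⊛ 0 X (λ i → Y ^ₚ (suc (s +ℕ i))) r)) ⟩
  (λ _ → + 0)                           ≈⟨ (λ r → sym (ℤ.+-inverseʳ ((Y ^ₚ s) r))) ⟩
  Y ^ₚ s ⊖ Y ^ₚ s                       ≡⟨ cong (λ t → Y ^ₚ t ⊖ Y ^ₚ s) (sym (ℕ.+-identityʳ s)) ⟩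
  Y ^ₚ (s +ℕ 0) ⊖ Y ^ₚ s                ∎
  where open ≈-Reasoning
geometric (suc n) s = begin
  X ⊛ (Y ^ₚ (suc (s +ℕ 0)) ⊕ ∑ₚ n (λ i → Y ^ₚ (suc (s +ℕ suc i))))
    ≈⟨ ⊛-cong {f = X} ≈-refl (⊕-cong (λ r → cong (λ t → (Y ^ₚ (suc t)) r) (ℕ.+-identityʳ s))
                       (∑ₚ-cong n (λ i r → cong (λ t → (Y ^ₚ (suc t)) r) (ℕ.+-suc s i)))) ⟩
  X ⊛ (Y ^ₚ suc s ⊕ ∑ₚ n (λ i → Y ^ₚ (suc (suc s +ℕ i))))
    ≈⟨ solve 3 (λ x a b → x :* (a :+ b) := x :* a :+ x :* b) ≈-refl X (Y ^ₚ suc s) (∑ₚ n (λ i → Y ^ₚ (suc (suc s +ℕ i)))) ⟩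
  X ⊛ Y ^ₚ suc s ⊕ X ⊛ ∑ₚ n (λ i → Y ^ₚ (suc (suc s +ℕ i)))
    ≈⟨ ⊕-cong {x = X ⊛ Y ^ₚ suc s} ≈-refl (geometric n (suc s)) ⟩
  X ⊛ Y ^ₚ suc s ⊕ (Y ^ₚ (suc s +ℕ n) ⊖ Y ^ₚ suc s)
    ≈⟨ combine (⊝ Y ^ₚ s) Y-eq
         (solve 4 (λ x y p q → x :* (y :* p) :+ (q :- y :* p) :+ (:- p) :* K (+ 1)
                            := q :- p :+ (:- p) :* ((K (+ 1) :- x) :* y))
                ≈-refl X Y (Y ^ₚ s) (Y ^ₚ (suc s +ℕ n))) ⟩
  Y ^ₚ (suc s +ℕ n) ⊖ Y ^ₚ s
    ≡⟨ cong (λ t → Y ^ₚ t ⊖ Y ^ₚ s) (sym (ℕ.+-suc s n)) ⟩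
  Y ^ₚ (s +ℕ suc n) ⊖ Y ^ₚ s ∎
  where open ≈-Reasoning

-- Generating functions of the continuations of each state

fallingGF : ℕ → PS
fallingGF k zero    = + 1
fallingGF k (suc r) = ∑ (suc k) (λ j → fallingGF j r)

-- The two equal summands stand for the next entries `k` and `M`, which both preserve the state.
valleyGF : ℕ → PS
valleyGF k zero    = + 1
valleyGF k (suc r) = ∑ k (λ j → fallingGF j r) + (valleyGF k r + valleyGF k r)

-- A Rising prefix has second largest value m, maximum m + d and length m + d + h.
risingGF : ℕ → ℕ → ℕ → PS
risingGF h d m zero    = + 1
risingGF h d m (suc r) = ∑ m (λ k → fallingGF k r)
                       + (∑ d (λ i → valleyGF (m +ℕ i) r)
                       + (risingGF (suc h) d m r
                       + ∑ h (λ i → risingGF (h ∸ i) (suc i) (m +ℕ d) r)))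

^ₚ-0 : ∀ f k → f 0 ≡ + 1 → (f ^ₚ k) 0 ≡ + 1
^ₚ-0 f zero    p = refl
^ₚ-0 f (suc k) p = cong₂ _*_ p (^ₚ-0 f k p)

fallingGF-eq : ∀ k → fallingGF k ≈ Y ^ₚ suc k
fallingGF-eq k zero    = sym (^ₚ-0 Y (suc k) refl)
fallingGF-eq k (suc r) = begin
  ∑ (suc k) (λ j → fallingGF j r)               ≡⟨ ∑-cong (suc k) (λ j _ → fallingGF-eq j r) ⟩
  ∑ₚ (suc k) (λ j → Y ^ₚ suc j) r               ≡⟨ sym (X-suc (∑ₚ (suc k) (λ j → Y ^ₚ suc j)) r) ⟩
  (X ⊛ ∑ₚ (suc k) (λ j → Y ^ₚ suc j)) (suc r)   ≡⟨ geometric (suc k) 0 (suc r) ⟩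
  (Y ^ₚ suc k) (suc r) + + 0                    ≡⟨ ℤ.+-identityʳ _ ⟩
  (Y ^ₚ suc k) (suc r)                          ∎
  where open ≡-Reasoning

fallingGF-∑ : ∀ k → X ⊛ ∑ₚ k fallingGF ≈ Y ^ₚ k ⊖ con (+ 1)
fallingGF-∑ k = ≈-trans (⊛-cong {f = X} ≈-refl (∑ₚ-cong k fallingGF-eq)) (geometric k 0)

-- The recursion reads T = 1 + x(s + 2T), and xs = Y^k - 1 by `fallingGF-∑`.
valleyGF-eq : ∀ k → (con (+ 1) ⊖ con (+ 2) ⊛ X) ⊛ valleyGF k ≈ Y ^ₚ k
valleyGF-eq k =
  combine (con (+ 1)) (shift-eq {valleyGF k} {∑ₚ k fallingGF ⊕ (valleyGF k ⊕ valleyGF k)} refl (λ _ → refl))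
  (combine (con (+ 1)) (fallingGF-∑ k)
    (solve 4 (λ x t s p → (K (+ 1) :- K (+ 2) :* x) :* t :+ K (+ 1) :* (K (+ 1) :+ x :* (s :+ (t :+ t))) :+ K (+ 1) :* (p :- K (+ 1))
                        := p :+ K (+ 1) :* t :+ K (+ 1) :* (x :* s))
      ≈-refl X (valleyGF k) (∑ₚ k fallingGF) (Y ^ₚ k)))

valleyGF-∑ : ∀ d m → (con (+ 1) ⊖ con (+ 2) ⊛ X) ⊛ (X ⊛ ∑ₚ d (λ i → valleyGF (m +ℕ i)))
              ≈ (con (+ 1) ⊖ X) ⊛ (Y ^ₚ (m +ℕ d) ⊖ Y ^ₚ m)
valleyGF-∑ d m = begin
  u ⊛ (X ⊛ ∑ₚ d (λ i → valleyGF (m +ℕ i)))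
    ≈⟨ solve 3 (λ u x s → u :* (x :* s) := x :* (u :* s)) ≈-refl u X (∑ₚ d (λ i → valleyGF (m +ℕ i))) ⟩
  X ⊛ (u ⊛ ∑ₚ d (λ i → valleyGF (m +ℕ i)))
    ≈⟨ ⊛-cong {f = X} ≈-refl (≈-trans (≈-sym (∑ₚ-⊛ d u _)) (∑ₚ-cong d (λ i → valleyGF-eq (m +ℕ i)))) ⟩
  X ⊛ ∑ₚ d (λ i → Y ^ₚ (m +ℕ i))
    -- The factor (1-x)Y = 1 is inserted because `geometric` needs every exponent raised by one.
    ≈⟨ combine (⊝ (X ⊛ s)) Y-eq (solve 3 (λ x y s → x :* s :+ (:- (x :* s)) :* K (+ 1)
         := (K (+ 1) :- x) :* (x :* (y :* s)) :+ (:- (x :* s)) :* ((K (+ 1) :- x) :* y)) ≈-refl X Y s) ⟩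
  (con (+ 1) ⊖ X) ⊛ (X ⊛ (Y ⊛ s))
    ≈⟨ ⊛-cong {f = con (+ 1) ⊖ X} ≈-refl (≈-trans (⊛-cong {f = X} ≈-refl (≈-sym (∑ₚ-⊛ d Y _))) (geometric d m)) ⟩
  (con (+ 1) ⊖ X) ⊛ (Y ^ₚ (m +ℕ d) ⊖ Y ^ₚ m) ∎
  where
  open ≈-Reasoning
  u s : PS
  u = con (+ 1) ⊖ con (+ 2) ⊛ X
  s = ∑ₚ d (λ i → Y ^ₚ (m +ℕ i))

-- The kernel root as a fixed point

module Fixpoint (Φ : PS → PS) (contractive : ∀ n {f g : PS} → (∀ m → m <ℕ n → f m ≡ g m) → Φ f n ≡ Φ g n) where

  iterate : ℕ → PS
  iterate zero    = con (+ 0)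
  iterate (suc k) = Φ (iterate k)

  -- Coefficient `n` is read off the first iterate that is guaranteed to be final there.
  fix : PS
  fix n = iterate (suc n) n

  -- A coefficient of `Φ f` depends only on lower coefficients of `f`, so every application of `Φ`
  -- settles one more coefficient.
  iterate-stable : ∀ k n → n <ℕ k → iterate (suc k) n ≡ iterate k n
  iterate-stable (suc k) n n<1+k = contractive n λ m m<n →
    iterate-stable k m (ℕ.<-≤-trans m<n (ℕ.≤-pred n<1+k))

  iterate-fix : ∀ k n → n <ℕ k → iterate k n ≡ fix n
  iterate-fix (suc k) n n<1+k with ℕ.m≤n⇒m<n∨m≡n (ℕ.≤-pred n<1+k)
  ... | inj₁ n<k  = trans (iterate-stable k n n<k) (iterate-fix k n n<k)
  ... | inj₂ refl = refl

  fix-eq : fix ≈ Φ fix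
  fix-eq n = contractive n (λ m m<n → iterate-fix n m m<n)

λ-step : PS → PS
λ-step f = Y ⊕ X ⊛ (f ⊛ f)

-- The factor `X` delays the square by one degree.
λ-step-contractive : ∀ n {f g : PS} → (∀ m → m <ℕ n → f m ≡ g m) → λ-step f n ≡ λ-step g n
λ-step-contractive zero    p = refl
λ-step-contractive (suc n) {f} {g} p = cong (λ z → + 1 + z) (begin
  (X ⊛ (f ⊛ f)) (suc n)  ≡⟨ X-suc (f ⊛ f) n ⟩
  (f ⊛ f) n              ≡⟨ convSum-cong n n (λ i i≤n → p i (s≤s i≤n)) (λ i i≤n → p i (s≤s i≤n)) ⟩
  (g ⊛ g) n              ≡⟨ sym (X-suc (g ⊛ g) n) ⟩
  (X ⊛ (g ⊛ g)) (suc n)  ∎)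
  where open ≡-Reasoning

Λ : PS
Λ = Fixpoint.fix λ-step λ-step-contractive

Λ-eq : Λ ≈ Y ⊕ X ⊛ (Λ ⊛ Λ)
Λ-eq = Fixpoint.fix-eq λ-step λ-step-contractive

-- The closed form for Rising states

A B C D E Q : PS
A = con (+ 2) ⊖ con (+ 2) ⊛ X ⊕ con (+ 2) ⊛ (X ⊛ X)
B = (con (+ 1) ⊖ con (+ 2) ⊛ X) ⊛ (con (+ 2) ⊖ con (+ 2) ⊛ X ⊕ X ⊛ X)
C = X ⊛ X ⊛ Y ⊛ (con (+ 2) ⊖ X)
D = (con (+ 1) ⊖ X) ⊛ ((con (+ 2) ⊖ X) ⊛ (con (+ 2) ⊖ X))
E = X ⊛ Y ⊛ ((con (+ 2) ⊖ X) ⊛ (con (+ 2) ⊖ X))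
Q = (con (+ 2) ⊖ X) ⊛ (con (+ 2) ⊖ X) ⊛ (con (+ 1) ⊖ con (+ 2) ⊛ X)

G : ℕ → PS
G h = A ⊖ C ⊛ num h ⊕ B ⊛ Λ ^ₚ suc h

-- The candidate for `Q ⊛ risingGF h d m`, where m + d is the maximum of the prefix.
closed : ℕ → ℕ → ℕ → PS
closed h d m = Y ^ₚ (m +ℕ d) ⊛ G h ⊖ E ⊛ Y ^ₚ m

-- K₀ᵖ and Kᵖ are the quotients by (1-x)Y - 1 needed in rises-eq, found by rewriting xY to Y - 1.
module Syntax {n : ℕ} where
  P : Set
  P = Solver.Polynomial n

  2-x 1-x 1-2x Aᵖ Bᵖ Dᵖ Qᵖ K₀ᵖ : P → P
  2-x x = K (+ 2) :- x
  1-x x = K (+ 1) :- x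
  1-2x x = K (+ 1) :- K (+ 2) :* x
  Aᵖ x = K (+ 2) :- K (+ 2) :* x :+ K (+ 2) :* (x :* x)
  Bᵖ x = 1-2x x :* (K (+ 2) :- K (+ 2) :* x :+ x :* x)
  Dᵖ x = 1-x x :* (2-x x :* 2-x x)
  Qᵖ x = 2-x x :* 2-x x :* 1-2x x
  K₀ᵖ x = K (+ 2) :- K (+ 4) :* x :+ x :* x :+ x :* x :* x

  Cᵖ Eᵖ : P → P → P
  Cᵖ x y = x :* x :* y :* 2-x x
  Eᵖ x y = x :* y :* (2-x x :* 2-x x)

  Gᵖ : P → P → P → P → P → P
  Gᵖ x y l H L = Aᵖ x :- Cᵖ x y :* H :+ Bᵖ x :* (l :* L)

  Kᵖ : P → P → P → P
  Kᵖ x y H = K₀ᵖ x :+ x :* x :* y :* H :* (x :- K (+ 2))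

open Syntax

-- This is `closed-eq` solved for the sum over new maxima, with the common factor `Y ^ₚ M` removed.
risesClosed : ℕ → PS
risesClosed h = G h ⊖ X ⊛ G (suc h) ⊕ X ⊛ E ⊛ num h ⊖ D

rises : ℕ → ℕ → PS
rises h M = ∑ₚ h (λ i → Y ^ₚ (M +ℕ suc i) ⊛ G (h ∸ i))

K₀ : PS
K₀ = con (+ 2) ⊖ con (+ 4) ⊛ X ⊕ X ⊛ X ⊕ X ⊛ X ⊛ X

-- Induction on `h` with `M` varying: once the first summand is split off, the others form
-- `rises h (suc M)`. The kernel equation turns Λ - xΛ² into `Y`, which matches the powers of `Λ` on
-- both sides; the rest is an identity modulo (1-x)Y = 1.
rises-eq : ∀ h M → X ⊛ rises h M ≈ Y ^ₚ M ⊛ risesClosed h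
rises-eq zero M = ≈-trans (≈-sym (∑ₚ-⊛ 0 X (λ i → Y ^ₚ (M +ℕ suc i) ⊛ G (0 ∸ i)))) (≈-trans (≈-sym con-0)
  -- With no summands the claim becomes G 0 - x G 1 = D, which ties `A`, `B`, `C` and `D` together.
  (combine (⊝ (Y ^ₚ M ⊛ K₀)) Y-eq (combine (⊝ (Y ^ₚ M ⊛ B)) Λ-eq
    (solve 4 (λ x y l p →
       K (+ 0) :+ (:- (p :* K₀ᵖ x)) :* K (+ 1) :+ (:- (p :* Bᵖ x)) :* (y :+ x :* (l :* l))
       := p :* (Gᵖ x y l (K (+ 0)) (K (+ 1)) :- x :* Gᵖ x y l (K (+ 1) :+ K (+ 0)) (l :* K (+ 1)) :+ x :* Eᵖ x y :* K (+ 0) :- Dᵖ x)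
          :+ (:- (p :* K₀ᵖ x)) :* ((K (+ 1) :- x) :* y) :+ (:- (p :* Bᵖ x)) :* l)
     ≈-refl X Y Λ (Y ^ₚ M)))))
rises-eq (suc h) M = begin
  X ⊛ (Y ^ₚ (M +ℕ 1) ⊛ G (suc h) ⊕ ∑ₚ h (λ i → Y ^ₚ (M +ℕ suc (suc i)) ⊛ G (h ∸ i)))
    ≈⟨ ⊛-cong {f = X} ≈-refl (⊕-cong
         (λ r → cong (λ t → (Y ^ₚ t ⊛ G (suc h)) r) (trans (ℕ.+-suc M 0) (cong suc (ℕ.+-identityʳ M))))
         (∑ₚ-cong h (λ i r → cong (λ t → (Y ^ₚ t ⊛ G (h ∸ i)) r) (ℕ.+-suc M (suc i))))) ⟩
  X ⊛ (Y ^ₚ suc M ⊛ G (suc h) ⊕ rises h (suc M))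
    ≈⟨ combine (con (+ 1)) (rises-eq h (suc M)) (combine (⊝ (Y ^ₚ M ⊛ k)) Y-eq
         (combine (⊝ (Y ^ₚ M ⊛ B ⊛ (Λ ⊛ Λ ^ₚ h))) Λ-eq
         (solve 7 (λ x y l p H L R →
            let g₀ = Gᵖ x y l H L
                g₁ = Gᵖ x y l (K (+ 1) :+ H) (l :* L)
                g₂ = Gᵖ x y l (K (+ 1) :+ (K (+ 1) :+ H)) (l :* (l :* L))
                k₁ = :- (p :* Kᵖ x y H)
                k₂ = :- (p :* Bᵖ x :* (l :* L))
            in
            x :* (y :* p :* g₁ :+ R) :+ K (+ 1) :* (y :* p :* (g₀ :- x :* g₁ :+ x :* Eᵖ x y :* H :- Dᵖ x))
              :+ k₁ :* K (+ 1) :+ k₂ :* (y :+ x :* (l :* l))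
            := p :* (g₁ :- x :* g₂ :+ x :* Eᵖ x y :* (K (+ 1) :+ H) :- Dᵖ x) :+ K (+ 1) :* (x :* R)
              :+ k₁ :* ((K (+ 1) :- x) :* y) :+ k₂ :* l)
         ≈-refl X Y Λ (Y ^ₚ M) (num h) (Λ ^ₚ h) (rises h (suc M))))) ⟩
  Y ^ₚ M ⊛ risesClosed (suc h) ∎
  where
  open ≈-Reasoning
  k : PS
  k = K₀ ⊕ X ⊛ X ⊛ Y ⊛ num h ⊛ (X ⊖ con (+ 2))

-- `Q` times the part of the Rising recursion that involves no Rising state: the empty continuation,
-- the falls below `m` and the valleys from `m` up to `M`. Its coefficient at `Y ^ₚ M` is `D`.
source : ℕ → ℕ → PS
source M m = (con (+ 2) ⊖ X) ⊛ (con (+ 2) ⊖ X) ⊛ ((con (+ 1) ⊖ X) ⊛ Y ^ₚ M ⊖ X ⊛ Y ^ₚ m)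

-- The terms in `Y ^ₚ m` cancel because (1-x)E = x(2-x)²; those in `Y ^ₚ (m +ℕ d)` are `rises-eq`.
closed-eq : ∀ h d m → closed h d m ≈
  source (m +ℕ d) m ⊕ X ⊛ (closed (suc h) d m ⊕ ∑ₚ h (λ i → closed (h ∸ i) (suc i) (m +ℕ d)))
closed-eq h d m =
  combine (⊝ con (+ 1)) (rises-eq h (m +ℕ d))
  (combine (⊝ X) ∑-closed
  (combine (⊝ (Y ^ₚ m ⊛ ((con (+ 2) ⊖ X) ⊛ (con (+ 2) ⊖ X)) ⊛ X)) Y-eq
  (solve 9 (λ x y H p q g₀ g₁ R S →
     let E′ = Eᵖ x y
         k = :- (q :* (2-x x :* 2-x x) :* x)
     in
     p :* g₀ :- E′ :* q
       :+ (:- K (+ 1)) :* (p :* (g₀ :- x :* g₁ :+ x :* E′ :* H :- Dᵖ x))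
       :+ (:- x) :* (R :+ H :* (:- (E′ :* p))) :+ k :* K (+ 1)
     := 2-x x :* 2-x x :* ((K (+ 1) :- x) :* p :- x :* q) :+ x :* ((p :* g₁ :- E′ :* q) :+ S)
       :+ (:- K (+ 1)) :* (x :* R)
       :+ (:- x) :* S :+ k :* ((K (+ 1) :- x) :* y))
   ≈-refl X Y (num h) (Y ^ₚ (m +ℕ d)) (Y ^ₚ m) (G h) (G (suc h)) (rises h (m +ℕ d))
     (∑ₚ h (λ i → closed (h ∸ i) (suc i) (m +ℕ d))))))
  where
  ∑-closed : ∑ₚ h (λ i → closed (h ∸ i) (suc i) (m +ℕ d)) ≈ rises h (m +ℕ d) ⊕ num h ⊛ ⊝ (E ⊛ Y ^ₚ (m +ℕ d))
  ∑-closed = ≈-trans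
    (∑ₚ-⊕ h (λ i → Y ^ₚ (m +ℕ d +ℕ suc i) ⊛ G (h ∸ i)) (λ _ → ⊝ (E ⊛ Y ^ₚ (m +ℕ d))))
    (⊕-cong {x = rises h (m +ℕ d)} ≈-refl (∑ₚ-const h (⊝ (E ⊛ Y ^ₚ (m +ℕ d)))))

-- The defining recursion times `Q`, with the falling and valley sums evaluated; it has the shape of
-- `closed-eq`.
risingGF-eq : ∀ h d m → Q ⊛ risingGF h d m ≈
  source (m +ℕ d) m ⊕ X ⊛ (Q ⊛ risingGF (suc h) d m ⊕ ∑ₚ h (λ i → Q ⊛ risingGF (h ∸ i) (suc i) (m +ℕ d)))
risingGF-eq h d m =
  combine Q (shift-eq {risingGF h d m} {∑ₚ m fallingGF ⊕ (∑ₚ d (λ i → valleyGF (m +ℕ i)) ⊕ (risingGF (suc h) d m ⊕ later))}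
                      refl (λ _ → refl))
  (combine Q (fallingGF-∑ m)
  (combine ((con (+ 2) ⊖ X) ⊛ (con (+ 2) ⊖ X)) (valleyGF-∑ d m)
  (combine (⊝ X) (∑ₚ-⊛ h Q (λ i → risingGF (h ∸ i) (suc i) (m +ℕ d)))
  (solve 9 (λ x p q w w′ s₁ s₂ s₃ S →
     let t = 2-x x :* 2-x x
     in
     Qᵖ x :* w :+ Qᵖ x :* (K (+ 1) :+ x :* (s₁ :+ (s₂ :+ (w′ :+ s₃))))
       :+ Qᵖ x :* (q :- K (+ 1)) :+ t :* ((K (+ 1) :- x) :* (p :- q)) :+ (:- x) :* (Qᵖ x :* s₃)
     := t :* ((K (+ 1) :- x) :* p :- x :* q) :+ x :* (Qᵖ x :* w′ :+ S)
       :+ Qᵖ x :* w :+ Qᵖ x :* (x :* s₁) :+ t :* (1-2x x :* (x :* s₂)) :+ (:- x) :* S)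
   ≈-refl X (Y ^ₚ (m +ℕ d)) (Y ^ₚ m) (risingGF h d m) (risingGF (suc h) d m) (∑ₚ m fallingGF) (∑ₚ d (λ i → valleyGF (m +ℕ i))) later
     (∑ₚ h (λ i → Q ⊛ risingGF (h ∸ i) (suc i) (m +ℕ d)))))))
  where
  later : PS
  later = ∑ₚ h (λ i → risingGF (h ∸ i) (suc i) (m +ℕ d))

-- In the shared recursion the unknowns occur only behind a factor `X`, so coefficient `r` is fixed
-- by coefficients r - 1 at other parameters. Hence the induction on `r` is uniform in `h`, `d` and
-- `m`.
risingGF-closed : ∀ r h d m → (Q ⊛ risingGF h d m) r ≡ closed h d m r
risingGF-closed r h d m = trans (risingGF-eq h d m r) (trans (cong (λ z → source (m +ℕ d) m r + z) (later r)) (sym (closed-eq h d m r)))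
  where
  later : ∀ r → (X ⊛ (Q ⊛ risingGF (suc h) d m ⊕ ∑ₚ h (λ i → Q ⊛ risingGF (h ∸ i) (suc i) (m +ℕ d)))) r
              ≡ (X ⊛ (closed (suc h) d m ⊕ ∑ₚ h (λ i → closed (h ∸ i) (suc i) (m +ℕ d)))) r
  later zero    = refl
  later (suc r) = begin
    (X ⊛ (Q ⊛ risingGF (suc h) d m ⊕ ∑ₚ h (λ i → Q ⊛ risingGF (h ∸ i) (suc i) (m +ℕ d)))) (suc r)
      ≡⟨ X-suc _ r ⟩
    (Q ⊛ risingGF (suc h) d m) r + ∑ h (λ i → (Q ⊛ risingGF (h ∸ i) (suc i) (m +ℕ d)) r)
      ≡⟨ cong₂ _+_ (risingGF-closed r (suc h) d m) (∑-cong h (λ i _ → risingGF-closed r (h ∸ i) (suc i) (m +ℕ d))) ⟩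
    closed (suc h) d m r + ∑ h (λ i → closed (h ∸ i) (suc i) (m +ℕ d) r)
      ≡⟨ sym (X-suc _ r) ⟩
    (X ⊛ (closed (suc h) d m ⊕ ∑ₚ h (λ i → closed (h ∸ i) (suc i) (m +ℕ d)))) (suc r) ∎
    where open ≡-Reasoning

-- The square root

⊛-cancel-2 : ∀ f g → g 0 ≡ + 2 → f ⊛ g ≈ con (+ 0) → f ≈ con (+ 0)
⊛-cancel-2 f g g₀ fg≈0 zero    = ℤ.*-cancelʳ-≡ (f 0) (+ 0) (+ 2) (trans (cong (λ z → f 0 * z) (sym g₀)) (fg≈0 0))
⊛-cancel-2 f g g₀ fg≈0 (suc n) = trans (⊛-cancel-2 (tail f) g g₀ tail-fg≈0 n) (con-0 n)
  where
  f₀ : f 0 ≡ + 0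
  f₀ = ⊛-cancel-2 f g g₀ fg≈0 0
  tail-fg≈0 : tail f ⊛ g ≈ con (+ 0)
  tail-fg≈0 n = begin
    (tail f ⊛ g) n                    ≡⟨ sym (ℤ.+-identityˡ _) ⟩
    + 0 * g (suc n) + (tail f ⊛ g) n  ≡⟨ cong (λ z → z * g (suc n) + (tail f ⊛ g) n) (sym f₀) ⟩
    f 0 * g (suc n) + (tail f ⊛ g) n  ≡⟨ sym (⊛-tailˡ f g n) ⟩
    (f ⊛ g) (suc n)                   ≡⟨ fg≈0 (suc n) ⟩
    + 0                               ≡⟨ sym (con-0 n) ⟩
    con (+ 0) n                       ∎
    where open ≡-Reasoning

-- (f - g)(f + g) = 0, and f + g has constant term 2, so it can be cancelled.
sqrt-unique : ∀ f g → f 0 ≡ + 1 → g 0 ≡ + 1 → f ⊛ f ≈ g ⊛ g → f ≈ g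
sqrt-unique f g f₀ g₀ ff≈gg = combine (con (+ 1))
  (⊛-cancel-2 (f ⊖ g) (f ⊕ g) (cong₂ _+_ f₀ g₀)
    (combine (con (+ 1)) ff≈gg (solve 2 (λ f g → (f :- g) :* (f :+ g) :+ K (+ 1) :* (g :* g)
                                          := K (+ 0) :+ K (+ 1) :* (f :* f)) ≈-refl f g)))
  (solve 2 (λ f g → f :+ K (+ 1) :* K (+ 0) := g :+ K (+ 1) :* (f :- g)) ≈-refl f g)

poly-∷ : ∀ c cs → poly (c ∷ cs) ≈ con c ⊕ X ⊛ poly cs
poly-∷ c cs zero    = sym (ℤ.+-identityʳ c)
poly-∷ c cs (suc n) = sym (trans (ℤ.+-identityˡ _) (X-suc (poly cs) n))

-- Unlike `poly`, this form is an expression in `con` and `X` that the solver can process.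
horner : List ℤ → PS
horner []           = con (+ 0)
horner (c ∷ [])     = con c
horner (c ∷ d ∷ cs) = con c ⊕ X ⊛ horner (d ∷ cs)

poly-horner : ∀ cs → poly cs ≈ horner cs
poly-horner []           n = sym (con-0 n)
poly-horner (c ∷ [])     n = refl
poly-horner (c ∷ d ∷ cs) n =
  trans (poly-∷ c (d ∷ cs) n) (cong (λ z → con c n + z) (⊛-cong {f = X} ≈-refl (poly-horner (d ∷ cs)) n))

-- Completing the square in the kernel equation gives (1-2xΛ)² = 1 - 4xY. Multiplied by (1-x)² this
-- is (1-x)² - 4x(1-x) = 1 - 6x + 5x², and the constant term 1 selects the root.
S-Λ : ∀ S → S 0 ≡ + 1 → (∀ n → (S ⊛ S) n ≡ poly (+ 1 ∷ -[1+ 5 ] ∷ + 5 ∷ []) n) →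
      S ≈ (con (+ 1) ⊖ X) ⊛ (con (+ 1) ⊖ con (+ 2) ⊛ X ⊛ Λ)
S-Λ S S₀ SS = sqrt-unique S _ S₀ refl
  (combine (con (+ 1)) (≈-trans SS (poly-horner (+ 1 ∷ -[1+ 5 ] ∷ + 5 ∷ [])))
  (combine (con (+ 4) ⊛ X ⊛ (con (+ 1) ⊖ X) ⊛ (con (+ 1) ⊖ X)) Λ-eq
  (combine (con (+ 4) ⊛ X ⊛ (con (+ 1) ⊖ X)) Y-eq
  (solve 4 (λ x y l s →
     let r = (K (+ 1) :- x) :* (K (+ 1) :- K (+ 2) :* x :* l)
         k₁ = K (+ 4) :* x :* (K (+ 1) :- x) :* (K (+ 1) :- x)
         k₂ = K (+ 4) :* x :* (K (+ 1) :- x)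
     in s :* s :+ K (+ 1) :* (K (+ 1) :+ x :* (K -[1+ 5 ] :+ x :* K (+ 5)))
          :+ k₁ :* (y :+ x :* (l :* l)) :+ k₂ :* K (+ 1)
     := r :* r :+ K (+ 1) :* (s :* s) :+ k₁ :* l :+ k₂ :* ((K (+ 1) :- x) :* y))
   ≈-refl X Y Λ S))))

-- Extending avoiding prefixes

⊆-∷ʳ⁻ : ∀ (τ : List ℕ) {c} σ {k} → τ ++ [ c ] ⊆ σ ++ [ k ] → τ ++ [ c ] ⊆ σ ⊎ (τ ⊆ σ × c ≡ k)
⊆-∷ʳ⁻ []          []      (refl ∷ _) = inj₂ ([] , refl)
⊆-∷ʳ⁻ []          []      (_ ∷ʳ ())
⊆-∷ʳ⁻ (_ ∷ [])    []      (_ ∷ ())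
⊆-∷ʳ⁻ (_ ∷ _ ∷ _) []      (_ ∷ ())
⊆-∷ʳ⁻ (_ ∷ _)     []      (_ ∷ʳ ())
⊆-∷ʳ⁻ τ           (x ∷ σ) (.x ∷ʳ p)  = Sum.map (x ∷ʳ_) (λ (q , e) → x ∷ʳ q , e) (⊆-∷ʳ⁻ τ σ p)
⊆-∷ʳ⁻ []          (x ∷ σ) (refl ∷ p) = inj₁ (refl ∷ minimum σ)
⊆-∷ʳ⁻ (_ ∷ τ)     (x ∷ σ) (refl ∷ p) = Sum.map (refl ∷_) (λ (q , e) → refl ∷ q , e) (⊆-∷ʳ⁻ τ σ p)

⊆-∷ʳ⁺ : ∀ {τ σ : List ℕ} {k} → τ ⊆ σ → τ ++ [ k ] ⊆ σ ++ [ k ]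
⊆-∷ʳ⁺ p = ++⁺ p ⊆-refl

last-⊆ : ∀ {σ : List ℕ} {k} → [ k ] ⊆ σ ++ [ k ]
last-⊆ {σ} = ⊆-∷ʳ⁺ (minimum σ)

grow : ∀ {τ σ : List ℕ} {k} → τ ⊆ σ → τ ⊆ σ ++ [ k ]
grow {k = k} p = ++⁺ʳ [ k ] p

Good : List ℕ → Set
Good σ = ∀ {a b c} → a ∷ b ∷ c ∷ [] ⊆ σ → b <ℕ a → b <ℕ c → a ≡ c

-- The part of `Good` for the extended sequence that concerns triples ending in the new entry `k`.
Allowed : List ℕ → ℕ → Set
Allowed σ k = ∀ {a b} → a ∷ b ∷ [] ⊆ σ → b <ℕ a → b <ℕ k → a ≡ k

Good-∷ʳ : ∀ {σ k} → Good σ → Allowed σ k → Good (σ ++ [ k ])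
Good-∷ʳ {σ} good ok {a} {b} p b<a b<c with ⊆-∷ʳ⁻ (a ∷ b ∷ []) σ p
... | inj₁ q          = good q b<a b<c
... | inj₂ (q , refl) = ok q b<a b<c

Good-init : ∀ {σ k} → Good (σ ++ [ k ]) → Good σ
Good-init good p = good (grow p)

Good-last : ∀ {σ k} → Good (σ ++ [ k ]) → Allowed σ k
Good-last good p = good (⊆-∷ʳ⁺ p)

Allowed-∷ʳ : ∀ {σ k v} → Allowed σ v → (∀ {a} → [ a ] ⊆ σ → k <ℕ a → k <ℕ v → a ≡ v) → Allowed (σ ++ [ k ]) v
Allowed-∷ʳ {σ} ok new {a} p b<a b<v with ⊆-∷ʳ⁻ (a ∷ []) σ p
... | inj₁ q          = ok q b<a b<v
... | inj₂ (q , refl) = new q b<a b<v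

Allowed-init : ∀ {σ k v} → Allowed (σ ++ [ k ]) v → Allowed σ v
Allowed-init ok p = ok (grow p)

Allowed-last : ∀ {σ k v a} → Allowed (σ ++ [ k ]) v → [ a ] ⊆ σ → k <ℕ a → k <ℕ v → a ≡ v
Allowed-last ok p = ok (⊆-∷ʳ⁺ p)

-- Pattern avoidance as a condition on triples

subseqs-⊆ : ∀ {P : List ℕ → Set} σ → Any P (subseqs σ) → ∃ λ τ → τ ⊆ σ × P τ
subseqs-⊆ []      (here p) = [] , [] , p
subseqs-⊆ (x ∷ σ) p with Any.++⁻ (map (x ∷_) (subseqs σ)) p
... | inj₁ q = let τ , τ⊆σ , pτ = subseqs-⊆ σ (Any.map⁻ q) in x ∷ τ , refl ∷ τ⊆σ , pτ
... | inj₂ q = let τ , τ⊆σ , pτ = subseqs-⊆ σ q in τ , x ∷ʳ τ⊆σ , pτ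

⊆-subseqs : ∀ {P : List ℕ → Set} {τ σ} → τ ⊆ σ → P τ → Any P (subseqs σ)
⊆-subseqs []         p = here p
⊆-subseqs (x ∷ʳ q)   p = Any.++⁺ʳ _ (⊆-subseqs q p)
⊆-subseqs (refl ∷ q) p = Any.++⁺ˡ (Any.map⁺ (⊆-subseqs q p))

Avoids : List ℕ → Set
Avoids = AvoidsAll (p102 ∷ p201 ∷ [])

avoids? : ∀ σ → Dec (Avoids σ)
avoids? = avoidsAll? (p102 ∷ p201 ∷ [])

Good⇒Avoids : ∀ {σ} → Good σ → Avoids σ
Good⇒Avoids {σ} good = (λ c → no102 (subseqs-⊆ σ c)) ∷ (λ c → no201 (subseqs-⊆ σ c)) ∷ []
  where
  no102 : ¬ ∃ λ τ → τ ⊆ σ × OrderIso τ p102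
  no102 (a ∷ b ∷ c ∷ [] , p , (ab ∷ ac ∷ []) , (bc ∷ []) , _) =
    ℕ.<⇒≢ (proj₂ (proj₁ ac) (s≤s (s≤s z≤n)))
          (good p (proj₂ (proj₂ ab) (s≤s z≤n)) (proj₂ (proj₁ bc) (s≤s z≤n)))
  no102 (a ∷ b ∷ c ∷ _ ∷ _ , _ , _ , _ , _ , ())
  no201 : ¬ ∃ λ τ → τ ⊆ σ × OrderIso τ p201
  no201 (a ∷ b ∷ c ∷ [] , p , (ab ∷ ac ∷ []) , (bc ∷ []) , _) =
    ℕ.<⇒≢ (proj₂ (proj₂ ac) (s≤s (s≤s z≤n)))
          (sym (good p (proj₂ (proj₂ ab) (s≤s z≤n)) (proj₂ (proj₁ bc) (s≤s z≤n))))
  no201 (a ∷ b ∷ c ∷ _ ∷ _ , _ , _ , _ , _ , ())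

sameOrder-< : ∀ {a b x y} → a <ℕ x → b <ℕ y → SameOrder a b x y
sameOrder-< a<x b<y = ((λ _ → b<y) , λ _ → a<x) , (λ x<a → ⊥-elim (ℕ.<-asym a<x x<a)) , λ y<b → ⊥-elim (ℕ.<-asym b<y y<b)

sameOrder-> : ∀ {a b x y} → x <ℕ a → y <ℕ b → SameOrder a b x y
sameOrder-> x<a y<b = proj₂ (sameOrder-< x<a y<b) , proj₁ (sameOrder-< x<a y<b)

Avoids⇒Good : ∀ {σ} → Avoids σ → Good σ
Avoids⇒Good (no102 ∷ no201 ∷ []) {a} {b} {c} p b<a b<c with ℕ.<-cmp a c
... | tri< a<c _ _ = ⊥-elim (no102 (⊆-subseqs p
  ( (sameOrder-> b<a (s≤s z≤n) ∷ sameOrder-< a<c (s≤s (s≤s z≤n)) ∷ []) , (sameOrder-< b<c (s≤s z≤n) ∷ []) , [] , tt)))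
... | tri≈ _ a≡c _ = a≡c
... | tri> _ _ c<a = ⊥-elim (no201 (⊆-subseqs p
  ( (sameOrder-> b<a (s≤s z≤n) ∷ sameOrder-> c<a (s≤s (s≤s z≤n)) ∷ []) , (sameOrder-< b<c (s≤s z≤n) ∷ []) , [] , tt)))

-- Counting by extending prefixes

indicator : ∀ {A : Set} → Dec A → ℤ
indicator d = if does d then + 1 else + 0

-- The number of avoiding extensions of σ, of length p, by r further entries.
completions : ℕ → List ℕ → ℕ → ℤ
completions p σ zero    = indicator (avoids? σ)
completions p σ (suc r) = ∑ (suc p) (λ k → completions (suc p) (σ ++ [ k ]) r)

sumOver : (List ℕ → ℤ) → List (List ℕ) → ℤ
sumOver f []       = + 0
sumOver f (σ ∷ σs) = f σ + sumOver f σs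

sumOver-++ : ∀ f σs τs → sumOver f (σs ++ τs) ≡ sumOver f σs + sumOver f τs
sumOver-++ f []       τs = sym (ℤ.+-identityˡ _)
sumOver-++ f (σ ∷ σs) τs = trans (cong (λ z → f σ + z) (sumOver-++ f σs τs)) (sym (ℤ.+-assoc (f σ) _ _))

sumOver-concatMap : ∀ f (g : List ℕ → List (List ℕ)) σs → sumOver f (concatMap g σs) ≡ sumOver (sumOver f ∘ g) σs
sumOver-concatMap f g []       = refl
sumOver-concatMap f g (σ ∷ σs) =
  trans (sumOver-++ f (g σ) _) (cong (λ z → sumOver f (g σ) + z) (sumOver-concatMap f g σs))

sumOver-cong : ∀ {f g} σs → (∀ σ → f σ ≡ g σ) → sumOver f σs ≡ sumOver g σs
sumOver-cong []       p = refl
sumOver-cong (σ ∷ σs) p = cong₂ _+_ (p σ) (sumOver-cong σs p)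

sumOver-applyUpTo : ∀ f (g : ℕ → List ℕ) u n → sumOver f (map g (applyUpTo u n)) ≡ ∑ n (f ∘ g ∘ u)
sumOver-applyUpTo f g u zero    = refl
sumOver-applyUpTo f g u (suc n) = cong (λ z → f (g (u 0)) + z) (sumOver-applyUpTo f g (u ∘ suc) n)

-- Moving the last entry of the prefix into the continuation keeps n + r fixed, until the prefix is
-- empty. The case r = 0 counts the avoiders in `invSeqs n`.
sumOver-invSeqs : ∀ n r → sumOver (λ σ → completions n σ r) (invSeqs n) ≡ completions 0 [] (n +ℕ r)
sumOver-invSeqs zero    r = ℤ.+-identityʳ _
sumOver-invSeqs (suc n) r = begin
  sumOver (λ σ → completions (suc n) σ r) (invSeqs (suc n))
    ≡⟨ sumOver-concatMap _ (λ σ → map (λ k → σ ++ [ k ]) (upTo (suc n))) (invSeqs n) ⟩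
  sumOver (λ σ → sumOver (λ σ → completions (suc n) σ r) (map (λ k → σ ++ [ k ]) (upTo (suc n)))) (invSeqs n)
    ≡⟨ sumOver-cong (invSeqs n) (λ σ → sumOver-applyUpTo (λ σ → completions (suc n) σ r) (λ k → σ ++ [ k ]) id (suc n)) ⟩
  sumOver (λ σ → completions n σ (suc r)) (invSeqs n)
    ≡⟨ sumOver-invSeqs n (suc r) ⟩
  completions 0 [] (n +ℕ suc r)
    ≡⟨ cong (completions 0 []) (ℕ.+-suc n r) ⟩
  completions 0 [] (suc n +ℕ r) ∎
  where open ≡-Reasoning

length-filter : ∀ {P : List ℕ → Set} (P? : ∀ σ → Dec (P σ)) σs →
                + length (filter P? σs) ≡ sumOver (indicator ∘ P?) σs
length-filter P? []       = refl
length-filter P? (σ ∷ σs) with does (P? σ)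
... | true  = cong (λ z → + 1 + z) (length-filter P? σs)
... | false = trans (length-filter P? σs) (sym (ℤ.+-identityˡ _))

F-completions : ∀ n → F n ≡ completions 0 [] n
F-completions n = trans (length-filter avoids? (invSeqs n))
  (trans (sumOver-invSeqs n 0) (cong (completions 0 []) (ℕ.+-identityʳ n)))

∑-zero : ∀ n {f} → (∀ i → f i ≡ + 0) → ∑ n f ≡ + 0
∑-zero zero    p = refl
∑-zero (suc n) p = cong₂ _+_ (p 0) (∑-zero n (p ∘ suc))

∑-+ : ∀ m n f → ∑ (m +ℕ n) f ≡ ∑ m f + ∑ n (f ∘ (m +ℕ_))
∑-+ zero    n f = sym (ℤ.+-identityˡ _)
∑-+ (suc m) n f = trans (cong (λ z → f 0 + z) (∑-+ m n (f ∘ suc))) (sym (ℤ.+-assoc (f 0) _ _))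

completions-good : ∀ p {σ} → Good σ → completions p σ 0 ≡ + 1
completions-good p {σ} good = cong (λ b → if b then + 1 else + 0) (dec-true (avoids? σ) (Good⇒Avoids good))

-- Prefixes of good sequences are good, so a bad prefix never recovers.
completions-bad : ∀ p {σ} r → ¬ Good σ → completions p σ r ≡ + 0
completions-bad p {σ} zero    bad = cong (λ b → if b then + 1 else + 0) (dec-false (avoids? σ) (bad ∘ Avoids⇒Good))
completions-bad p {σ} (suc r) bad = ∑-zero (suc p) (λ k → completions-bad (suc p) r (bad ∘ Good-init {k = k}))

-- The three states and their transitions

record Falling (k : ℕ) (σ : List ℕ) : Set where
  field
    good    : Good σ
    allowed : ∀ {v} → v ≤ℕ k → Allowed σ v
    blocked : ∀ {v} → k <ℕ v → ¬ Allowed σ v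
    above   : ∃ λ a → [ a ] ⊆ σ × k <ℕ a

record Valley (k M : ℕ) (σ : List ℕ) : Set where
  field
    good     : Good σ
    allowed  : ∀ {v} → v ≤ℕ k → Allowed σ v
    allowed′ : Allowed σ M
    blocked  : ∀ {v} → k <ℕ v → v ≢ M → ¬ Allowed σ v
    k<M      : k <ℕ M
    k∈       : [ k ] ⊆ σ
    M∈       : [ M ] ⊆ σ
    above    : ∀ {a} → [ a ] ⊆ σ → k <ℕ a → a ≡ M

-- The guards 0 < m + d and 0 < m let the empty prefix be Rising with d = m = 0.
record Rising (d m : ℕ) (σ : List ℕ) : Set where
  field
    good    : Good σ
    allowed : ∀ v → Allowed σ v
    bound   : ∀ {a} → [ a ] ⊆ σ → a ≤ℕ m ⊎ a ≡ m +ℕ d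
    top     : 0 <ℕ m +ℕ d → [ m +ℕ d ] ⊆ σ
    second  : 0 <ℕ m → [ m ] ⊆ σ × 0 <ℕ d

Allowed-∷ʳ-≤ : ∀ {σ k v} → v ≤ℕ k → Allowed σ v → Allowed (σ ++ [ k ]) v
Allowed-∷ʳ-≤ v≤k ok = Allowed-∷ʳ ok (λ _ _ k<v → ⊥-elim (ℕ.<⇒≱ k<v v≤k))

-- An entry w > v is excluded already if w > k. If w ≤ k, the recorded entry a > k lies above `v`
-- and differs from w, so w is excluded now.
falling-falling : ∀ {k v σ} → Falling k σ → v ≤ℕ k → Falling v (σ ++ [ v ])
falling-falling {k} {v} {σ} f v≤k = record
  { good    = Good-∷ʳ good (allowed v≤k)
  ; allowed = λ w≤v → Allowed-∷ʳ-≤ w≤v (allowed (ℕ.≤-trans w≤v v≤k))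
  ; blocked = blocked′
  ; above   = a , grow a∈ , ℕ.≤-<-trans v≤k k<a }
  where
  open Falling f
  a : ℕ
  a = proj₁ above
  a∈ : [ a ] ⊆ σ
  a∈ = proj₁ (proj₂ above)
  k<a : k <ℕ a
  k<a = proj₂ (proj₂ above)
  blocked′ : ∀ {w} → v <ℕ w → ¬ Allowed (σ ++ [ v ]) w
  blocked′ {w} v<w ok with ℕ.<-≤-connex k w
  ... | inj₁ k<w = blocked k<w (Allowed-init ok)
  ... | inj₂ w≤k = ℕ.<⇒≢ (ℕ.≤-<-trans w≤k k<a) (sym (Allowed-last ok a∈ (ℕ.≤-<-trans v≤k k<a) v<w))

-- A later entry above `v` would have to equal both `a` and `b`, which differ.
falling-new : ∀ {v a b σ} → Good σ → (∀ {w} → w ≤ℕ v → Allowed σ w) →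
              [ a ] ⊆ σ → [ b ] ⊆ σ → v <ℕ a → a <ℕ b → Falling v (σ ++ [ v ])
falling-new {v} {a} {b} {σ} good allowed a∈ b∈ v<a a<b = record
  { good    = Good-∷ʳ good (allowed ℕ.≤-refl)
  ; allowed = λ w≤v → Allowed-∷ʳ-≤ w≤v (allowed w≤v)
  ; blocked = λ v<w ok → ℕ.<⇒≢ a<b (trans (Allowed-last ok a∈ v<a v<w)
                                     (sym (Allowed-last ok b∈ (ℕ.<-trans v<a a<b) v<w)))
  ; above   = a , grow a∈ , v<a }

valley-falling : ∀ {k M v σ} → Valley k M σ → v <ℕ k → Falling v (σ ++ [ v ])
valley-falling v v<k = falling-new good (λ w≤v → allowed (ℕ.≤-trans w≤v (ℕ.<⇒≤ v<k))) k∈ M∈ v<k k<M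
  where open Valley v

valley-valley : ∀ {k M v σ} → Valley k M σ → v ≡ k ⊎ v ≡ M → Valley k M (σ ++ [ v ])
valley-valley {k} {M} {v} {σ} s v≡ = record
  { good     = Good-∷ʳ good v-allowed
  ; allowed  = λ w≤k → Allowed-∷ʳ-≤ (ℕ.≤-trans w≤k k≤v) (allowed w≤k)
  ; allowed′ = Allowed-∷ʳ allowed′ (λ a∈ v<a _ → above a∈ (ℕ.≤-<-trans k≤v v<a))
  ; blocked  = λ k<w w≢M ok → blocked k<w w≢M (Allowed-init ok)
  ; k<M      = k<M
  ; k∈       = grow k∈
  ; M∈       = grow M∈
  ; above    = λ a∈ k<a → [ (λ a∈σ → above a∈σ k<a) , (λ { (_ , refl) → [ (λ { refl → ⊥-elim (ℕ.<-irrefl refl k<a) }) , id ]′ v≡ }) ]′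
                            (⊆-∷ʳ⁻ [] σ a∈) }
  where
  open Valley s
  k≤v : k ≤ℕ v
  k≤v = [ (λ { refl → ℕ.≤-refl }) , (λ { refl → ℕ.<⇒≤ k<M }) ]′ v≡
  v-allowed : Allowed σ v
  v-allowed = [ (λ { refl → allowed ℕ.≤-refl }) , (λ { refl → allowed′ }) ]′ v≡

-- The two distinct values above `k` are `m` and m + d; k < m makes `m` positive, which opens the
-- guards of `top` and `second`.
rising-falling : ∀ {d m k σ} → Rising d m σ → k <ℕ m → Falling k (σ ++ [ k ])
rising-falling {d} {m} s k<m = falling-new good (λ {w} _ → allowed w) (proj₁ (second 0<m))
    (top (ℕ.<-≤-trans 0<m (ℕ.m≤m+n m d))) k<m (ℕ.m<m+n m (proj₂ (second 0<m)))
  where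
  open Rising s
  0<m : 0 <ℕ m
  0<m = ℕ.≤-<-trans z≤n k<m

-- By `bound`, every entry other than the maximum is at most `m`, so only the maximum lies above m +
-- i.
rising-valley : ∀ {d m i σ} → Rising d m σ → i <ℕ d → Valley (m +ℕ i) (m +ℕ d) (σ ++ [ m +ℕ i ])
rising-valley {d} {m} {i} {σ} s i<d = record
  { good     = Good-∷ʳ good (allowed k)
  ; allowed  = λ {v} v≤k → Allowed-∷ʳ-≤ v≤k (allowed v)
  ; allowed′ = Allowed-∷ʳ (allowed M) (λ a∈ k<a _ → above′ a∈ k<a)
  ; blocked  = λ k<v v≢M ok → v≢M (sym (Allowed-last ok M∈′ k<M′ k<v))
  ; k<M      = k<M′
  ; k∈       = last-⊆
  ; M∈       = grow M∈′
  ; above    = λ a∈ k<a → [ (λ a∈σ → above′ a∈σ k<a) , (λ { (_ , refl) → ⊥-elim (ℕ.<-irrefl refl k<a) }) ]′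
                            (⊆-∷ʳ⁻ [] σ a∈) }
  where
  open Rising s
  k M : ℕ
  k = m +ℕ i
  M = m +ℕ d
  k<M′ : k <ℕ M
  k<M′ = ℕ.+-monoʳ-< m i<d
  M∈′ : [ M ] ⊆ σ
  M∈′ = top (ℕ.≤-<-trans z≤n k<M′)
  above′ : ∀ {a} → [ a ] ⊆ σ → k <ℕ a → a ≡ M
  above′ a∈ k<a = [ (λ a≤m → ⊥-elim (ℕ.<⇒≱ k<a (ℕ.≤-trans a≤m (ℕ.m≤m+n m i)))) , id ]′ (bound a∈)

rising-≤ : ∀ {d m a σ} → Rising d m σ → [ a ] ⊆ σ → a ≤ℕ m +ℕ d
rising-≤ {d} {m} s a∈ = [ (λ a≤m → ℕ.≤-trans a≤m (ℕ.m≤m+n m d)) , ℕ.≤-reflexive ]′ (Rising.bound s a∈)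

rising-allowed : ∀ {d m k σ} → Rising d m σ → m +ℕ d ≤ℕ k → ∀ v → Allowed (σ ++ [ k ]) v
rising-allowed s M≤k v = Allowed-∷ʳ (Rising.allowed s v)
  (λ a∈ k<a _ → ⊥-elim (ℕ.<⇒≱ k<a (ℕ.≤-trans (rising-≤ s a∈) M≤k)))

rising-plateau : ∀ {d m σ} → Rising d m σ → Rising d m (σ ++ [ m +ℕ d ])
rising-plateau {d} {m} {σ} s = record
  { good    = Good-∷ʳ good (allowed (m +ℕ d))
  ; allowed = rising-allowed s ℕ.≤-refl
  ; bound   = λ a∈ → [ bound , inj₂ ∘ proj₂ ]′ (⊆-∷ʳ⁻ [] σ a∈)
  ; top     = λ _ → last-⊆
  ; second  = λ 0<m → grow (proj₁ (second 0<m)) , proj₂ (second 0<m) }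
  where open Rising s

rising-rising : ∀ {d m σ} i → Rising d m σ → Rising (suc i) (m +ℕ d) (σ ++ [ m +ℕ d +ℕ suc i ])
rising-rising {d} {m} {σ} i s = record
  { good    = Good-∷ʳ good (allowed (m +ℕ d +ℕ suc i))
  ; allowed = rising-allowed s (ℕ.m≤m+n (m +ℕ d) (suc i))
  ; bound   = λ a∈ → Sum.map (rising-≤ s) proj₂ (⊆-∷ʳ⁻ [] σ a∈)
  ; top     = λ _ → last-⊆
  ; second  = λ 0<M → grow (top 0<M) , s≤s z≤n }
  where open Rising s

-- Completions of each state agree with its generating function

completions-falling : ∀ {k p σ} r → Falling k σ → k ≤ℕ p → completions p σ r ≡ fallingGF k r
completions-falling {k} {p} zero    s k≤p = completions-good p (Falling.good s)
completions-falling {k} {p} {σ} (suc r) s k≤p with ℕ.m≤n⇒∃[o]m+o≡n k≤p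
... | e , refl = begin
  ∑ (suc k +ℕ e) f                     ≡⟨ ∑-+ (suc k) e f ⟩
  ∑ (suc k) f + ∑ e (f ∘ (suc k +ℕ_))  ≡⟨ cong₂ _+_ (∑-cong (suc k) small) (∑-zero e large) ⟩
  fallingGF k (suc r) + + 0                  ≡⟨ ℤ.+-identityʳ _ ⟩
  fallingGF k (suc r)                        ∎
  where
  open ≡-Reasoning
  f : ℕ → ℤ
  f v = completions (suc p) (σ ++ [ v ]) r
  small : ∀ v → v <ℕ suc k → f v ≡ fallingGF v r
  small v v<1+k = let v≤k = ℕ.≤-pred v<1+k in
    completions-falling r (falling-falling s v≤k) (ℕ.≤-trans v≤k (ℕ.m≤n⇒m≤1+n k≤p))
  large : ∀ i → f (suc k +ℕ i) ≡ + 0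
  large i = completions-bad (suc p) r (Falling.blocked s (s≤s (ℕ.m≤m+n k i)) ∘ Good-last)

completions-valley : ∀ {k M p σ} r → Valley k M σ → M ≤ℕ p → completions p σ r ≡ valleyGF k r
completions-valley {p = p} zero    s M≤p = completions-good p (Valley.good s)
completions-valley {k} {M} {p} {σ} (suc r) s M≤p with ℕ.m≤n⇒∃[o]m+o≡n (Valley.k<M s) | ℕ.m≤n⇒∃[o]m+o≡n M≤p
... | g , refl | e , refl = begin
  ∑ (suc (suc (k +ℕ g) +ℕ e)) f
    ≡⟨ cong (λ t → ∑ t f) (rearrange k g e) ⟩
  -- With M = k + 1 + g and p = M + e, the range splits into the entries below `k`, `k` itself, the
  -- g values strictly between `k` and `M`, `M` itself, and the e values beyond `M`.
  ∑ (k +ℕ suc (g +ℕ suc e)) f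
    ≡⟨ ∑-+ k _ f ⟩
  ∑ k f + (f (k +ℕ 0) + ∑ (g +ℕ suc e) (λ i → f (k +ℕ suc i)))
    ≡⟨ cong (λ z → ∑ k f + (f (k +ℕ 0) + z)) (∑-+ g (suc e) (λ i → f (k +ℕ suc i))) ⟩
  ∑ k f + (f (k +ℕ 0) + (∑ g (λ i → f (k +ℕ suc i))
    + (f (k +ℕ suc (g +ℕ 0)) + ∑ e (λ i → f (k +ℕ suc (g +ℕ suc i))))))
    ≡⟨ cong₂ _+_ (∑-cong k small) (cong₂ _+_ (stay (inj₁ (ℕ.+-identityʳ k)))
       (cong₂ _+_ (trans (∑-cong g between) (∑-zero g (λ _ → refl))) (cong₂ _+_
          (stay (inj₂ (trans (ℕ.+-suc k _) (cong (λ t → suc (k +ℕ t)) (ℕ.+-identityʳ g)))))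
          (∑-zero e beyond)))) ⟩
  ∑ k (λ v → fallingGF v r) + (valleyGF k r + (+ 0 + (valleyGF k r + + 0)))
    ≡⟨ cong (λ z → ∑ k (λ v → fallingGF v r) + (valleyGF k r + z)) (trans (ℤ.+-identityˡ _) (ℤ.+-identityʳ _)) ⟩
  valleyGF k (suc r) ∎
  where
  open ≡-Reasoning
  rearrange : ∀ k g e → suc (suc (k +ℕ g) +ℕ e) ≡ k +ℕ suc (g +ℕ suc e)
  rearrange = ℕSolver.solve-∀
  f : ℕ → ℤ
  f v = completions (suc p) (σ ++ [ v ]) r
  small : ∀ v → v <ℕ k → f v ≡ fallingGF v r
  small v v<k = completions-falling r (valley-falling s v<k)
    (ℕ.<⇒≤ (ℕ.<-trans v<k (ℕ.<-≤-trans (Valley.k<M s) (ℕ.m≤n⇒m≤1+n M≤p))))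
  stay : ∀ {v} → v ≡ k ⊎ v ≡ M → f v ≡ valleyGF k r
  stay v≡ = completions-valley r (valley-valley s v≡) (ℕ.m≤n⇒m≤1+n M≤p)
  bad : ∀ {v} → k <ℕ v → v ≢ M → f v ≡ + 0
  bad k<v v≢M = completions-bad (suc p) r (Valley.blocked s k<v v≢M ∘ Good-last)
  between : ∀ i → i <ℕ g → f (k +ℕ suc i) ≡ + 0
  between i i<g = bad (ℕ.m<m+n k (s≤s z≤n))
    (ℕ.<⇒≢ (subst (λ t → t <ℕ M) (sym (ℕ.+-suc k i)) (s≤s (ℕ.+-monoʳ-< k i<g))))
  beyond : ∀ i → f (k +ℕ suc (g +ℕ suc i)) ≡ + 0
  beyond i = bad (ℕ.m<m+n k (s≤s z≤n))
    (ℕ.>⇒≢ (subst (λ t → M <ℕ t) (sym (ℕ.+-suc k _)) (s≤s (ℕ.+-monoʳ-< k (ℕ.m<m+n g (s≤s z≤n))))))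

-- Every next entry is allowed. The range 0 to p splits at `m` and at m + d into falls, valleys, a
-- repeated maximum and `h` possible new maxima; `h` measures how far the length exceeds the
-- maximum.
completions-rising : ∀ {h d m p σ} r → Rising d m σ → p ≡ m +ℕ d +ℕ h → completions p σ r ≡ risingGF h d m r
completions-rising {p = p} zero s refl = completions-good p (Rising.good s)
completions-rising {h} {d} {m} {p} {σ} (suc r) s refl = begin
  ∑ (suc (m +ℕ d +ℕ h)) f
    ≡⟨ cong (λ t → ∑ t f) (rearrange m d h) ⟩
  ∑ (m +ℕ (d +ℕ suc h)) f
    ≡⟨ ∑-+ m _ f ⟩
  ∑ m f + ∑ (d +ℕ suc h) (λ i → f (m +ℕ i))
    ≡⟨ cong (λ z → ∑ m f + z) (∑-+ d (suc h) (λ i → f (m +ℕ i))) ⟩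
  ∑ m f + (∑ d (λ i → f (m +ℕ i)) + (f (m +ℕ (d +ℕ 0)) + ∑ h (λ i → f (m +ℕ (d +ℕ suc i)))))
    ≡⟨ cong₂ _+_ (∑-cong m below) (cong₂ _+_ (∑-cong d valley) (cong₂ _+_ plateau (∑-cong h rise))) ⟩
  risingGF h d m (suc r) ∎
  where
  open ≡-Reasoning
  rearrange : ∀ m d h → suc (m +ℕ d +ℕ h) ≡ m +ℕ (d +ℕ suc h)
  rearrange = ℕSolver.solve-∀
  f : ℕ → ℤ
  f v = completions (suc p) (σ ++ [ v ]) r
  M≤1+p : m +ℕ d ≤ℕ suc p
  M≤1+p = ℕ.m≤n⇒m≤1+n (ℕ.m≤m+n (m +ℕ d) h)
  below : ∀ v → v <ℕ m → f v ≡ fallingGF v r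
  below v v<m = completions-falling r (rising-falling s v<m)
    (ℕ.≤-trans (ℕ.<⇒≤ v<m) (ℕ.≤-trans (ℕ.m≤m+n m d) M≤1+p))
  valley : ∀ i → i <ℕ d → f (m +ℕ i) ≡ valleyGF (m +ℕ i) r
  valley i i<d = completions-valley r (rising-valley s i<d) M≤1+p
  plateau : f (m +ℕ (d +ℕ 0)) ≡ risingGF (suc h) d m r
  plateau = trans (cong (λ t → f (m +ℕ t)) (ℕ.+-identityʳ d))
                  (completions-rising r (rising-plateau s) (sym (ℕ.+-suc (m +ℕ d) h)))
  rise : ∀ i → i <ℕ h → f (m +ℕ (d +ℕ suc i)) ≡ risingGF (h ∸ i) (suc i) (m +ℕ d) r
  rise i i<h = trans (cong f (sym (ℕ.+-assoc m d (suc i))))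
    -- The length grows by one and the maximum by i + 1, so the excess drops from `h` to h - i.
    (completions-rising r (rising-rising i s) (begin
      suc (m +ℕ d +ℕ h)                    ≡⟨ cong (λ t → suc (m +ℕ d +ℕ t)) (sym (ℕ.m+[n∸m]≡n (ℕ.<⇒≤ i<h))) ⟩
      suc (m +ℕ d +ℕ (i +ℕ (h ∸ i)))       ≡⟨ shuffle (m +ℕ d) i (h ∸ i) ⟩
      m +ℕ d +ℕ suc i +ℕ (h ∸ i)           ∎))
    where
    shuffle : ∀ a b c → suc (a +ℕ (b +ℕ c)) ≡ a +ℕ suc b +ℕ c
    shuffle = ℕSolver.solve-∀

-- The generating function of the avoiders

F-risingGF : F ≈ risingGF 0 0 0
F-risingGF n = trans (F-completions n) (completions-rising n rising-[] refl)
  where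
  rising-[] : Rising 0 0 []
  rising-[] = record
    { good = λ () ; allowed = λ _ () ; bound = λ () ; top = λ () ; second = λ () }

theorem24 : (S : PS) → S 0 ≡ + 1
    → (∀ n → (S ⊛ S) n ≡ poly (+ 1 ∷ -[1+ 5 ] ∷ + 5 ∷ []) n)
    → ∀ n → (F ⊛ (poly (+ 0 ∷ + 4 ∷ []) ⊛ poly (-[1+ 0 ] ∷ + 2 ∷ []) ⊛ poly (-[1+ 0 ] ∷ + 1 ∷ [])
    ⊛ poly (-[1+ 1 ] ∷ + 1 ∷ []) ⊛ poly (-[1+ 1 ] ∷ + 1 ∷ []))) n
    ≡ (poly (+ 4 ∷ -[1+ 7 ] ∷ -[1+ 9 ] ∷ + 18 ∷ -[1+ 7 ] ∷ [])
    ⊕ poly (+ 2 ∷ []) ⊛ poly (-[1+ 0 ] ∷ + 2 ∷ []) ⊛ poly (+ 2 ∷ -[1+ 1 ] ∷ + 1 ∷ []) ⊛ S) n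
theorem24 S S₀ SS = begin
  F ⊛ (poly (+ 0 ∷ + 4 ∷ []) ⊛ poly (-[1+ 0 ] ∷ + 2 ∷ []) ⊛ poly (-[1+ 0 ] ∷ + 1 ∷ [])
     ⊛ poly (-[1+ 1 ] ∷ + 1 ∷ []) ⊛ poly (-[1+ 1 ] ∷ + 1 ∷ []))
    ≈⟨ ⊛-cong F-risingGF (⊛-cong (⊛-cong (⊛-cong (⊛-cong (h₂ (+ 0) (+ 4)) (h₂ -[1+ 0 ] (+ 2))) (h₂ -[1+ 0 ] (+ 1)))
         (h₂ -[1+ 1 ] (+ 1))) (h₂ -[1+ 1 ] (+ 1))) ⟩
  I ⊛ (horner (+ 0 ∷ + 4 ∷ []) ⊛ horner (-[1+ 0 ] ∷ + 2 ∷ []) ⊛ horner (-[1+ 0 ] ∷ + 1 ∷ [])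
     ⊛ horner (-[1+ 1 ] ∷ + 1 ∷ []) ⊛ horner (-[1+ 1 ] ∷ + 1 ∷ []))
    -- The required denominator is 4x(1-x)Q, hence the first cofactor. At h = d = m = 0 the closed
    -- form is A + BΛ - E; the second cofactor removes the `Y` in `E`, and 4x(1-x)BΛ is the `Λ` term
    -- of the right-hand side.
    ≈⟨ combine (con (+ 4) ⊛ X ⊛ (con (+ 1) ⊖ X)) (λ r → risingGF-closed r 0 0 0)
       (combine (⊝ (con (+ 4) ⊛ X ⊛ X ⊛ (con (+ 2) ⊖ X) ⊛ (con (+ 2) ⊖ X))) Y-eq
       (solve 4 (λ x y l i →
          let k₁ = K (+ 4) :* x :* (K (+ 1) :- x)
              k₂ = :- (K (+ 4) :* x :* x :* 2-x x :* 2-x x)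
              lin = λ a b → K a :+ x :* K b
          in i :* (lin (+ 0) (+ 4) :* lin -[1+ 0 ] (+ 2) :* lin -[1+ 0 ] (+ 1) :* lin -[1+ 1 ] (+ 1) :* lin -[1+ 1 ] (+ 1))
               :+ k₁ :* (K (+ 1) :* Gᵖ x y l (K (+ 0)) (K (+ 1)) :- Eᵖ x y :* K (+ 1))
               :+ k₂ :* K (+ 1)
          := (K (+ 4) :+ x :* (K -[1+ 7 ] :+ x :* (K -[1+ 9 ] :+ x :* (K (+ 18) :+ x :* K -[1+ 7 ]))))
               :+ K (+ 2) :* lin -[1+ 0 ] (+ 2) :* (K (+ 2) :+ x :* (K -[1+ 1 ] :+ x :* K (+ 1)))
                  :* ((K (+ 1) :- x) :* (K (+ 1) :- K (+ 2) :* x :* l))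
               :+ k₁ :* (Qᵖ x :* i)
               :+ k₂ :* ((K (+ 1) :- x) :* y))
        ≈-refl X Y Λ I)) ⟩
  horner numerator ⊕ con (+ 2) ⊛ horner (-[1+ 0 ] ∷ + 2 ∷ []) ⊛ horner (+ 2 ∷ -[1+ 1 ] ∷ + 1 ∷ [])
     ⊛ ((con (+ 1) ⊖ X) ⊛ (con (+ 1) ⊖ con (+ 2) ⊛ X ⊛ Λ))
    ≈⟨ ≈-sym (⊕-cong (poly-horner numerator)
         (⊛-cong (⊛-cong (⊛-cong {f = con (+ 2)} ≈-refl (h₂ -[1+ 0 ] (+ 2)))
           (poly-horner (+ 2 ∷ -[1+ 1 ] ∷ + 1 ∷ []))) (S-Λ S S₀ SS))) ⟩
  poly numerator ⊕ poly (+ 2 ∷ []) ⊛ poly (-[1+ 0 ] ∷ + 2 ∷ []) ⊛ poly (+ 2 ∷ -[1+ 1 ] ∷ + 1 ∷ []) ⊛ S ∎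
  where
  open ≈-Reasoning
  I : PS
  I = risingGF 0 0 0
  numerator : List ℤ
  numerator = + 4 ∷ -[1+ 7 ] ∷ -[1+ 9 ] ∷ + 18 ∷ -[1+ 7 ] ∷ []
  h₂ : ∀ a b → poly (a ∷ b ∷ []) ≈ con a ⊕ X ⊛ con b
  h₂ a b = poly-horner (a ∷ b ∷ [])
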